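{- If $\mathcal{U}$ is an $[n,k]_{q^m/q}$ system with $n>2m-3$, then $\mathcal{U}$ is $2$-spannable.
   Context: Here $q$ is a prime power and $m,n,k$ are positive integers. An $[n,k]_{q^m/q}$ system is an $\mathbb{F}_q$-subspace $\mathcal{U}\subseteq\mathbb{F}_{q^m}^k$ of $\mathbb{F}_q$-dimension $n$ with $\langle\mathcal{U}\rangle_{\mathbb{F}_{q^m}}=\mathbb{F}_{q^m}^k$. It is $2$-spannable if there exist two $\mathbb{F}_{q^m}$-linear hyperplanes $\mathcal{H}_1,\mathcal{H}_2$ of $\mathbb{F}_{q^m}^k$ such that $\mathcal{U}=(\mathcal{H}_1\cap\mathcal{U})+(\mathcal{H}_2\cap\mathcal{U})$.
   Formalization: The formal theorem assumes k ≥ 2; for k = 1 the only hyperplane is {0}, so no system is 2-spannable, and the claim fails for (m,n,k) = (1,1,1) and (2,2,1), the only k = 1 cases with n > 2m−3. -}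

module Defs where

open import Algebra.Apartness.Bundles using (HeytingField; HeytingCommutativeRing)
open import Algebra.Bundles using (Ring; CommutativeRing)
open import Algebra.Module.Bundles using (LeftModule; LeftSemimodule)
open import Algebra.Module.Construct.TensorUnit using (leftModule)
open import Algebra.Morphism.Structures using (module RingMorphisms)
open import Data.Fin.Base using (Fin)
open import Data.Nat.Base using (ℕ; suc; _≥_; _^_)
open import Data.Nat.Primality using (Prime)
open import Data.Product.Base using (Σ-syntax; ∃-syntax; _×_; _,_)
open import Data.Vec.Functional using (Vector)
open import Function.Bundles using (Inverse)
open import Level using (Level; _⊔_; 0ℓ) renaming (suc to lsuc)
open import Relation.Binary.Bundles using (Setoid)
open import Relation.Binary.Definitions using (_Respects_)
open import Relation.Binary.PropositionalEquality.Core using (_≡_)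
open import Relation.Binary.PropositionalEquality.Properties using (setoid)
open import Relation.Unary using (Pred; _∈_; _∩_; _≐_; Universal)

private
  variable
    c ℓ₁ ℓ₂ r ℓr s ℓs v ℓv p p′ u : Level

IsPrimePower : Pred ℕ 0ℓ
IsPrimePower q = ∃[ p ] ∃[ e ] (Prime p × e ≥ 1 × q ≡ p ^ e)

HasCardinality : Setoid c ℓ₁ → ℕ → Set (c ⊔ ℓ₁)
HasCardinality S n = Inverse S (setoid (Fin n))

module LinearAlgebra {R : Ring r ℓr} (V : LeftModule R v ℓv) where

  open Ring R using (0#; _≈_) renaming (Carrier to Scalar)
  open LeftModule V
  open import Algebra.Definitions.RawMonoid
    (LeftSemimodule.+ᴹ-rawMonoid leftSemimodule) using (sum)

  linearCombination : ∀ {n} → Vector Scalar n → Vector Carrierᴹ n → Carrierᴹ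
  linearCombination a w = sum λ i → a i *ₗ w i

  Span : Pred Carrierᴹ p → Pred Carrierᴹ (r ⊔ v ⊔ ℓv ⊔ p)
  Span S x = ∃[ n ] Σ[ a ∈ Vector Scalar n ] Σ[ w ∈ Vector Carrierᴹ n ]
    ((∀ i → w i ∈ S) × x ≈ᴹ linearCombination a w)

  infixl 6 _+ˢ_
  _+ˢ_ : Pred Carrierᴹ p → Pred Carrierᴹ p′ → Pred Carrierᴹ (v ⊔ ℓv ⊔ p ⊔ p′)
  (S +ˢ T) x = ∃[ y ] ∃[ z ] (y ∈ S × z ∈ T × x ≈ᴹ y +ᴹ z)

  record IsSubspace (S : Pred Carrierᴹ p) : Set (r ⊔ v ⊔ ℓv ⊔ p) where
    field
      resp      : S Respects _≈ᴹ_
      0-closed  : 0ᴹ ∈ S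
      +-closed  : ∀ {x y} → x ∈ S → y ∈ S → x +ᴹ y ∈ S
      *ₗ-closed : ∀ a {x} → x ∈ S → a *ₗ x ∈ S

  LinearlyIndependent : ∀ {n} → Pred (Vector Carrierᴹ n) (r ⊔ ℓr ⊔ ℓv)
  LinearlyIndependent b =
    ∀ a → linearCombination a b ≈ᴹ 0ᴹ → ∀ i → a i ≈ 0#

  record IsBasisOf (S : Pred Carrierᴹ p) {n} (b : Vector Carrierᴹ n)
                   : Set (r ⊔ ℓr ⊔ v ⊔ ℓv ⊔ p) where
    field
      contained   : ∀ i → b i ∈ S
      independent : LinearlyIndependent b
      generates   : ∀ {x} → x ∈ S → ∃[ a ] (x ≈ᴹ linearCombination a b)

  HasDimension : Pred Carrierᴹ p → ℕ → Set (r ⊔ ℓr ⊔ v ⊔ ℓv ⊔ p)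
  HasDimension S n = Σ[ b ∈ Vector Carrierᴹ n ] IsBasisOf S b

power : {R : Ring r ℓr} → LeftModule R v ℓv → ℕ → LeftModule R v ℓv
power V k = record
  { Carrierᴹ = Vector Carrierᴹ k
  ; _≈ᴹ_ = λ x y → ∀ i → x i ≈ᴹ y i
  ; _+ᴹ_ = λ x y i → x i +ᴹ y i
  ; _*ₗ_ = λ a x i → a *ₗ x i
  ; 0ᴹ = λ _ → 0ᴹ
  ; -ᴹ_ = λ x i → -ᴹ x i
  ; isLeftModule = record
    { isLeftSemimodule = record
      { +ᴹ-isCommutativeMonoid = record
        { isMonoid = record
          { isSemigroup = record
            { isMagma = record
              { isEquivalence = record
                { refl = λ _ → ≈ᴹ-refl
                ; sym = λ e i → ≈ᴹ-sym (e i)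
                ; trans = λ e f i → ≈ᴹ-trans (e i) (f i)
                }
              ; ∙-cong = λ e f i → +ᴹ-cong (e i) (f i)
              }
            ; assoc = λ x y z i → +ᴹ-assoc (x i) (y i) (z i)
            }
          ; identity = (λ x i → +ᴹ-identityˡ (x i)) , (λ x i → +ᴹ-identityʳ (x i))
          }
        ; comm = λ x y i → +ᴹ-comm (x i) (y i)
        }
      ; isPreleftSemimodule = record
        { *ₗ-cong = λ e f i → *ₗ-cong e (f i)
        ; *ₗ-zeroˡ = λ x i → *ₗ-zeroˡ (x i)
        ; *ₗ-distribʳ = λ x a b i → *ₗ-distribʳ (x i) a b
        ; *ₗ-identityˡ = λ x i → *ₗ-identityˡ (x i)
        ; *ₗ-assoc = λ a b x i → *ₗ-assoc a b (x i)
        ; *ₗ-zeroʳ = λ a i → *ₗ-zeroʳ a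
        ; *ₗ-distribˡ = λ a x y i → *ₗ-distribˡ a (x i) (y i)
        }
      }
    ; -ᴹ‿cong = λ e i → -ᴹ‿cong (e i)
    ; -ᴹ‿inverse = (λ x i → -ᴹ‿inverseˡ (x i)) , (λ x i → -ᴹ‿inverseʳ (x i))
    }
  } where open LeftModule V

module _ {R : Ring r ℓr} {S : Ring s ℓs} where

  private
    module R = Ring R
    module S = Ring S
  open RingMorphisms R.rawRing S.rawRing using (IsRingHomomorphism)

  restrictScalars : {ι : R.Carrier → S.Carrier} → IsRingHomomorphism ι →
                    LeftModule S v ℓv → LeftModule R v ℓv
  restrictScalars {ι = ι} hom V = record
    { Carrierᴹ = Carrierᴹ
    ; _≈ᴹ_ = _≈ᴹ_
    ; _+ᴹ_ = _+ᴹ_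
    ; _*ₗ_ = λ a x → ι a *ₗ x
    ; 0ᴹ = 0ᴹ
    ; -ᴹ_ = -ᴹ_
    ; isLeftModule = record
      { isLeftSemimodule = record
        { +ᴹ-isCommutativeMonoid = +ᴹ-isCommutativeMonoid
        ; isPreleftSemimodule = record
          { *ₗ-cong = λ e f → *ₗ-cong (⟦⟧-cong e) f
          ; *ₗ-zeroˡ = λ x → ≈ᴹ-trans (*ₗ-congʳ 0#-homo) (*ₗ-zeroˡ x)
          ; *ₗ-distribʳ = λ x a b →
              ≈ᴹ-trans (*ₗ-congʳ (+-homo a b)) (*ₗ-distribʳ x (ι a) (ι b))
          ; *ₗ-identityˡ = λ x → ≈ᴹ-trans (*ₗ-congʳ 1#-homo) (*ₗ-identityˡ x)
          ; *ₗ-assoc = λ a b x →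
              ≈ᴹ-trans (*ₗ-congʳ (*-homo a b)) (*ₗ-assoc (ι a) (ι b) x)
          ; *ₗ-zeroʳ = λ a → *ₗ-zeroʳ (ι a)
          ; *ₗ-distribˡ = λ a x y → *ₗ-distribˡ (ι a) x y
          }
        }
      ; -ᴹ‿cong = -ᴹ‿cong
      ; -ᴹ‿inverse = -ᴹ‿inverse
      }
    }
    where
    open LeftModule V
    open IsRingHomomorphism hom

fieldRing : HeytingField c ℓ₁ ℓ₂ → Ring c ℓ₁
fieldRing F = CommutativeRing.ring
  (HeytingCommutativeRing.commutativeRing (HeytingField.heytingCommutativeRing F))

-- A homomorphism from a field with q elements to one with q ^ m elements is
-- injective, and counting shows that it makes the latter an extension of
-- degree m.  For finite carriers a Heyting field is the same as a discrete
-- field: apartness x # y means that x - y is invertible, which is decidable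
-- by search.
record FiniteFieldExtension (q m : ℕ) c ℓ₁ ℓ₂ : Set (lsuc (c ⊔ ℓ₁ ⊔ ℓ₂)) where
  field
    F : HeytingField c ℓ₁ ℓ₂
    K : HeytingField c ℓ₁ ℓ₂

  F-ring : Ring c ℓ₁
  F-ring = fieldRing F

  K-ring : Ring c ℓ₁
  K-ring = fieldRing K

  open RingMorphisms (Ring.rawRing F-ring) (Ring.rawRing K-ring)
    using (IsRingHomomorphism)

  field
    F-card : HasCardinality (Ring.setoid F-ring) q
    K-card : HasCardinality (Ring.setoid K-ring) (q ^ m)
    ι      : HeytingField.Carrier F → HeytingField.Carrier K
    ι-hom  : IsRingHomomorphism ι

module _ {q m : ℕ} (E : FiniteFieldExtension q m c ℓ₁ ℓ₂) (k : ℕ) where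

  open FiniteFieldExtension E

  K^k : LeftModule K-ring c ℓ₁
  K^k = power leftModule k

  K^k-over-F : LeftModule F-ring c ℓ₁
  K^k-over-F = restrictScalars ι-hom K^k

  private
    module 𝔽 = LinearAlgebra K^k-over-F
    module 𝕂 = LinearAlgebra K^k

  record IsSystem (n : ℕ) (U : Pred (LeftModule.Carrierᴹ K^k) u)
                  : Set (c ⊔ ℓ₁ ⊔ u) where
    field
      isSubspace : 𝔽.IsSubspace U
      dimension  : 𝔽.HasDimension U n
      spanning   : Universal (𝕂.Span U)

  IsHyperplane : Pred (LeftModule.Carrierᴹ K^k) p → Set (c ⊔ ℓ₁ ⊔ p)
  IsHyperplane H = 𝕂.IsSubspace H × ∃[ d ] (suc d ≡ k × 𝕂.HasDimension H d)

  -- The level c ⊔ ℓ₁ of the hyperplanes is no restriction, since the span of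
  -- a basis lives there.
  Is2Spannable : Pred (LeftModule.Carrierᴹ K^k) u → Set (lsuc (c ⊔ ℓ₁) ⊔ u)
  Is2Spannable U =
    Σ[ H₁ ∈ Pred (LeftModule.Carrierᴹ K^k) (c ⊔ ℓ₁) ]
    Σ[ H₂ ∈ Pred (LeftModule.Carrierᴹ K^k) (c ⊔ ℓ₁) ]
    (IsHyperplane H₁ × IsHyperplane H₂ × U ≐ ((H₁ ∩ U) 𝔽.+ˢ (H₂ ∩ U)))

{-# OPTIONS --safe #-}

-- Project K^k onto K² by u ↦ (u₀ + x ∙ u′ , u₁ + y ∙ u′), where u = (u₀ , u₁ , u′).
-- A nonzero vector is killed by at most a fraction |K|⁻² of the pairs (x , y),
-- so some projection π is injective on a given subspace of U of F-dimension
-- 2m − 2, and π U has F-codimension at most 2 in K²: it is the common kernel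
-- of two F-linear forms φ₁, φ₂ on K².  Each φᵢ vanishes on a K-line Lᵢ, because
-- K² has more elements than Hom_F (K , F).  If L₁ ≠ L₂, then K² = L₁ ⊕ L₂ and π U
-- is the sum of its intersections with L₁ and L₂; if L₁ = L₂, this line lies in
-- π U and any second line will do.  The preimages of the two lines under π are
-- the required hyperplanes.

module Submission where

open import Defs
open import Algebra.Apartness.Bundles using (HeytingField)
open import Algebra.Bundles using (CommutativeMonoid; Ring)
open import Algebra.Module.Bundles using (LeftModule)
open import Algebra.Module.Construct.TensorUnit using (leftModule)
import Algebra.Module.Properties.LeftModule as LeftModuleProperties
open import Algebra.Morphism.Structures using (module RingMorphisms)
import Algebra.Properties.CommutativeMonoid.Sum as Sum
import Algebra.Properties.Group as GroupProperties
open import Data.Fin.Base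
  using (Fin; zero; suc; combine; remQuot; funToFin; finToFun; punchIn; punchOut; _↑ˡ_; _↑ʳ_)
import Data.Fin.Properties as Fin
open import Data.Nat.Base as ℕ using (ℕ; zero; suc; _^_; _≤_; _<_; s≤s; z≤n)
import Data.Nat.Properties as ℕ
open import Data.Nat.Primality using (prime⇒nonTrivial)
open import Data.Product.Base using (Σ-syntax; ∃-syntax; _×_; _,_; proj₁; proj₂)
open import Data.Product.Relation.Binary.Pointwise.NonDependent using (×-setoid)
open import Data.Sum.Base using ([_,_]′)
open import Data.Vec.Functional using (Vector; []; _∷_; _++_; tail; insertAt; removeAt)
open import Data.Vec.Functional.Properties
  using (lookup-++ˡ; lookup-++ʳ; insertAt-lookup; insertAt-punchIn; insertAt-removeAt)
open import Data.Vec.Functional.Relation.Binary.Equality.Setoid using (≋-setoid)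
open import Function.Base using (_∘_; const)
open import Function.Bundles using (Inverse)
import Function.Construct.Identity as Identity
open import Level using (Level; _⊔_; Lift; lift)
open import Relation.Binary.Bundles using (Setoid)
open import Relation.Binary.Definitions using (Decidable; _Respects_)
open import Relation.Binary.PropositionalEquality.Core as ≡ using (_≡_)
open import Relation.Binary.PropositionalEquality.Properties using (setoid)
open import Relation.Nullary.Decidable.Core
  using (Dec; yes; no; map′; _×-dec_; ¬?; decidable-stable; toSum)
open import Relation.Nullary.Negation.Core using (¬_; contradiction)
open import Relation.Unary using (Pred; _∈_; _∩_)
import Relation.Unary as Unary

private
  variable
    a b ℓ ℓ′ c ℓ₁ ℓ₂ p r ℓr u v ℓv w ℓw : Level

-- Counting in finite setoids.

module _ {S : Setoid a ℓ} {n : ℕ} (card : HasCardinality S n) where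

  open Setoid S renaming (sym to ≈-sym; trans to ≈-trans)
  open Inverse card

  to-injective : ∀ {x y} → to x ≡ to y → x ≈ y
  to-injective e = ≈-trans (≈-sym (strictlyInverseʳ _)) (inverseʳ e)

  finite-≟ : Decidable _≈_
  finite-≟ x y = map′ to-injective to-cong (to x Fin.≟ to y)

  finite-any? : {P : Pred Carrier p} → P Respects _≈_ → Unary.Decidable P → Dec (∃[ x ] P x)
  finite-any? resp P? = map′
    (λ (i , h) → from i , h)
    (λ (x , h) → to x , resp (≈-sym (strictlyInverseʳ x)) h)
    (Fin.any? λ i → P? (from i))

pigeonhole : {A : Setoid a ℓ} {B : Setoid b ℓ′} {m n : ℕ} →
  HasCardinality A m → HasCardinality B n → n < m →
  (f : Setoid.Carrier A → Setoid.Carrier B) →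
  ∃[ x ] ∃[ y ] (¬ Setoid._≈_ A x y × Setoid._≈_ B (f x) (f y))
pigeonhole {A = A} cardA cardB n<m f
  with Fin.pigeonhole n<m (Inverse.to cardB ∘ f ∘ Inverse.from cardA)
... | i , j , i<j , e =
  from i , from j ,
  (λ x≈y → Fin.<⇒≢ i<j (≡.trans (≡.sym (strictlyInverseˡ i))
                          (≡.trans (to-cong x≈y) (strictlyInverseˡ j)))) ,
  to-injective cardB e
  where open Inverse cardA

injective⇒≤ : {A : Setoid a ℓ} {B : Setoid b ℓ′} {m n : ℕ} →
  HasCardinality A m → HasCardinality B n → (f : Setoid.Carrier A → Setoid.Carrier B) →
  (∀ {x y} → Setoid._≈_ B (f x) (f y) → Setoid._≈_ A x y) → m ≤ n
injective⇒≤ {A = A} {B = B} cardA cardB f injective = ℕ.≮⇒≥ λ n<m →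
  let _ , _ , x≉y , e = pigeonhole {A = A} {B = B} cardA cardB n<m f in x≉y (injective e)

module _ {S : Setoid a ℓ} {n : ℕ} (card : HasCardinality S n) where

  open Inverse card

  private
    funToFin-cong : ∀ {m n} {f g : Fin m → Fin n} → (∀ i → f i ≡ g i) → funToFin f ≡ funToFin g
    funToFin-cong {zero}  e = ≡.refl
    funToFin-cong {suc m} e = ≡.cong₂ combine (e zero) (funToFin-cong (e ∘ suc))

  vector-cardinality : ∀ k → HasCardinality (≋-setoid S k) (n ^ k)
  vector-cardinality k = record
    { to = λ x → funToFin (to ∘ x)
    ; from = λ i → from ∘ finToFun i
    ; to-cong = λ e → funToFin-cong (to-cong ∘ e)
    ; from-cong = λ { ≡.refl i → Setoid.refl S }
    ; inverse =
        (λ {i} e → ≡.trans (funToFin-cong (λ j → ≡.trans (to-cong (e j)) (strictlyInverseˡ _)))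
                           (Fin.funToFin-finToFin {k} i))
      , λ { {x} ≡.refl j → Setoid.trans S
              (from-cong (Fin.finToFun-funToFin (to ∘ x) j)) (strictlyInverseʳ _) }
    }

×-cardinality : {A : Setoid a ℓ} {B : Setoid b ℓ′} {m n : ℕ} →
  HasCardinality A m → HasCardinality B n → HasCardinality (×-setoid A B) (m ℕ.* n)
×-cardinality {A = A} {B = B} {m} {n} cardA cardB = record
  { to = λ (x , y) → combine (A.to x) (B.to y)
  ; from = λ i → let (j , k) = remQuot {m} n i in A.from j , B.from k
  ; to-cong = λ (e , e′) → ≡.cong₂ combine (A.to-cong e) (B.to-cong e′)
  ; from-cong = λ { ≡.refl → Setoid.refl (×-setoid A B) }
  ; inverse =
      (λ {i} (e , e′) → ≡.trans
        (≡.cong₂ combine (A.inverseˡ e) (B.inverseˡ e′)) (Fin.combine-remQuot {m} n i))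
    , λ { {x , y} ≡.refl →
        let e = Fin.remQuot-combine (A.to x) (B.to y)
        in A.inverseʳ (≡.cong proj₁ e) , B.inverseʳ (≡.cong proj₂ e) }
  }
  where
  module A = Inverse cardA
  module B = Inverse cardB

fin-cardinality : ∀ n → HasCardinality (setoid (Fin n)) n
fin-cardinality n = Identity.inverse (setoid (Fin n))

-- Finite fields: decidable equality and inverses.

module FiniteField (F : HeytingField c ℓ₁ ℓ₂) {n : ℕ}
                   (card : HasCardinality (Ring.setoid (fieldRing F)) n) where

  open HeytingField F using (#⇒invertible; tight)
  open Ring (fieldRing F)

  infix 4 _≟_
  _≟_ : Decidable _≈_
  _≟_ = finite-≟ card

  private
    x-0≈x : ∀ x → x - 0# ≈ x
    x-0≈x x = trans (+-congˡ (GroupProperties.ε⁻¹≈ε +-group)) (+-identityʳ x)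

    inverse? : ∀ x → Dec (∃[ y ] y * x ≈ 1#)
    inverse? x = finite-any? card (λ e h → trans (*-congʳ (sym e)) h) (λ y → y * x ≟ 1#)

  -- By tightness, x cannot fail to be apart from `0#`, which gives an inverse only up to double
  -- negation. Invertibility is decidable by search through the finite carrier, so the double
  -- negation can be removed.
  inverse : ∀ x → ¬ x ≈ 0# → ∃[ y ] y * x ≈ 1#
  inverse x x≉0 = decidable-stable (inverse? x) λ ¬inv →
    x≉0 (proj₁ (tight x 0#) λ x#0 →
      let y , y*[x-0] , _ = #⇒invertible x#0
      in ¬inv (y , trans (*-congˡ (sym (x-0≈x x))) y*[x-0]))

-- Linear maps between modules.

record IsLinear {R : Ring r ℓr} (V : LeftModule R v ℓv) (W : LeftModule R w ℓw)
                (f : LeftModule.Carrierᴹ V → LeftModule.Carrierᴹ W)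
                : Set (r ⊔ v ⊔ ℓv ⊔ ℓw) where
  private
    module V = LeftModule V
    module W = LeftModule W
  field
    cong    : ∀ {x y} → x V.≈ᴹ y → f x W.≈ᴹ f y
    +-homo  : ∀ x y → f (x V.+ᴹ y) W.≈ᴹ f x W.+ᴹ f y
    *ₗ-homo : ∀ s x → f (s V.*ₗ x) W.≈ᴹ s W.*ₗ f x

module _ {R : Ring r ℓr} {V : LeftModule R v ℓv} {W : LeftModule R w ℓw}
         {f : LeftModule.Carrierᴹ V → LeftModule.Carrierᴹ W} (linear : IsLinear V W f) where

  private
    module R = Ring R
    module V = LeftModule V
  open LeftModule W
  open IsLinear linear
  open LinearAlgebra

  0-homo : f V.0ᴹ ≈ᴹ 0ᴹ
  0-homo = ≈ᴹ-trans (cong (V.≈ᴹ-sym (V.*ₗ-zeroˡ V.0ᴹ))) (≈ᴹ-trans (*ₗ-homo R.0# V.0ᴹ) (*ₗ-zeroˡ _))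

  -ᴹ-homo : ∀ x → f (V.-ᴹ x) ≈ᴹ -ᴹ f x
  -ᴹ-homo x = LeftModuleProperties.inverseˡ-uniqueᴹ W (f (V.-ᴹ x)) (f x)
    (≈ᴹ-trans (≈ᴹ-sym (+-homo _ _)) (≈ᴹ-trans (cong (V.-ᴹ‿inverseˡ x)) 0-homo))

  linearCombination-homo : ∀ {n} (a : Vector R.Carrier n) w →
    f (linearCombination V a w) ≈ᴹ linearCombination W a (f ∘ w)
  linearCombination-homo {zero}  a w = 0-homo
  linearCombination-homo {suc n} a w =
    ≈ᴹ-trans (+-homo _ _) (+ᴹ-cong (*ₗ-homo _ _) (linearCombination-homo (tail a) (tail w)))

  trivialKernel⇒injective : (∀ x → f x ≈ᴹ 0ᴹ → x V.≈ᴹ V.0ᴹ) → ∀ {x y} → f x ≈ᴹ f y → x V.≈ᴹ y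
  trivialKernel⇒injective kernel {x} {y} e =
    V.≈ᴹ-trans (LeftModuleProperties.inverseˡ-uniqueᴹ V x (V.-ᴹ y)
                 (kernel _ (≈ᴹ-trans (+-homo _ _)
                   (≈ᴹ-trans (+ᴹ-cong e (-ᴹ-homo y)) (-ᴹ‿inverseʳ _)))))
               (LeftModuleProperties.-ᴹ-involutive V y)

module _ {R : Ring r ℓr} {V : LeftModule R v ℓv} {W : LeftModule R w ℓw} {X : LeftModule R u ℓ} where

  ∘-linear : {f : LeftModule.Carrierᴹ V → LeftModule.Carrierᴹ W}
             {g : LeftModule.Carrierᴹ W → LeftModule.Carrierᴹ X} →
             IsLinear W X g → IsLinear V W f → IsLinear V X (g ∘ f)
  ∘-linear G F = record
    { cong    = G.cong ∘ F.cong
    ; +-homo  = λ x y → ≈ᴹ-trans (G.cong (F.+-homo x y)) (G.+-homo _ _)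
    ; *ₗ-homo = λ s x → ≈ᴹ-trans (G.cong (F.*ₗ-homo s x)) (G.*ₗ-homo s _)
    }
    where
    module G = IsLinear G
    module F = IsLinear F
    open LeftModule X using (≈ᴹ-trans)

-- Linear combinations, spans and coordinates.

module _ {R : Ring r ℓr} (V : LeftModule R v ℓv) where

  open Ring R using (_≈_; 0#; 1#) renaming (Carrier to Scalar)
  private module R = Ring R
  open LeftModule V
  open LinearAlgebra V
  open Sum +ᴹ-commutativeMonoid using (sum-cong-≋; sum-replicate-zero)

  -- The family is fixed and only the coefficients vary, so that over a finite field membership is a
  -- finite search. In `Span` the length and the vectors vary as well.
  SpanOf : ∀ {n} → Vector Carrierᴹ n → Pred Carrierᴹ (r ⊔ ℓv)
  SpanOf b x = ∃[ a ] x ≈ᴹ linearCombination a b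

  linearCombination-cong : ∀ {n} {a a′ : Vector Scalar n} {w w′ : Vector Carrierᴹ n} →
    (∀ i → a i ≈ a′ i) → (∀ i → w i ≈ᴹ w′ i) → linearCombination a w ≈ᴹ linearCombination a′ w′
  linearCombination-cong e e′ = sum-cong-≋ λ i → *ₗ-cong (e i) (e′ i)

  linearCombination-0 : ∀ {n} {a : Vector Scalar n} w → (∀ i → a i ≈ 0#) → linearCombination a w ≈ᴹ 0ᴹ
  linearCombination-0 {n} w e =
    ≈ᴹ-trans (sum-cong-≋ λ i → ≈ᴹ-trans (*ₗ-congʳ (e i)) (*ₗ-zeroˡ _)) (sum-replicate-zero n)

  linearCombination-0ʳ : ∀ {n} (a : Vector Scalar n) {w} → (∀ i → w i ≈ᴹ 0ᴹ) → linearCombination a w ≈ᴹ 0ᴹ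
  linearCombination-0ʳ {n} a e =
    ≈ᴹ-trans (sum-cong-≋ λ i → ≈ᴹ-trans (*ₗ-congˡ (e i)) (*ₗ-zeroʳ _)) (sum-replicate-zero n)

  linearCombination-linear : ∀ {n} (w : Vector Carrierᴹ n) →
    IsLinear (power leftModule n) V (λ a → linearCombination a w)
  linearCombination-linear w = record
    { cong    = λ e → linearCombination-cong e (λ _ → ≈ᴹ-refl)
    ; +-homo  = +-homo w
    ; *ₗ-homo = *ₗ-homo w
    }
    where
    open import Algebra.Properties.CommutativeSemigroup
      (CommutativeMonoid.commutativeSemigroup +ᴹ-commutativeMonoid)
      using (interchange)
    +-homo : ∀ {n} (w : Vector Carrierᴹ n) a a′ →
      linearCombination (λ i → a i R.+ a′ i) w ≈ᴹ linearCombination a w +ᴹ linearCombination a′ w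
    +-homo {zero}  w a a′ = ≈ᴹ-sym (+ᴹ-identityˡ 0ᴹ)
    +-homo {suc n} w a a′ = ≈ᴹ-trans
      (+ᴹ-cong (*ₗ-distribʳ _ _ _) (+-homo (tail w) (tail a) (tail a′))) (interchange _ _ _ _)
    *ₗ-homo : ∀ {n} (w : Vector Carrierᴹ n) s a →
      linearCombination (λ i → s R.* a i) w ≈ᴹ s *ₗ linearCombination a w
    *ₗ-homo {zero}  w s a = ≈ᴹ-sym (*ₗ-zeroʳ s)
    *ₗ-homo {suc n} w s a = ≈ᴹ-trans
      (+ᴹ-cong (*ₗ-assoc _ _ _) (*ₗ-homo (tail w) s (tail a))) (≈ᴹ-sym (*ₗ-distribˡ _ _ _))

  linearCombination-injective : ∀ {n} {w : Vector Carrierᴹ n} → LinearlyIndependent w →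
    ∀ {a a′} → linearCombination a w ≈ᴹ linearCombination a′ w → ∀ i → a i ≈ a′ i
  linearCombination-injective {w = w} = trivialKernel⇒injective (linearCombination-linear w)

  tail-independent : ∀ d {n} {w : Vector Carrierᴹ (d ℕ.+ n)} →
    LinearlyIndependent w → LinearlyIndependent (w ∘ (d ↑ʳ_))
  tail-independent zero    ind = ind
  tail-independent (suc d) ind = tail-independent d λ a e i →
    ind (0# ∷ a) (≈ᴹ-trans (+ᴹ-cong (*ₗ-zeroˡ _) e) (+ᴹ-identityˡ _)) (suc i)

  module _ {S : Pred Carrierᴹ p} (subspace : IsSubspace S) where

    open IsSubspace subspace

    linearCombination-closed : ∀ {n} a {w : Vector Carrierᴹ n} → (∀ i → w i ∈ S) → linearCombination a w ∈ S
    linearCombination-closed {zero}  a h = 0-closed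
    linearCombination-closed {suc n} a h =
      +-closed (*ₗ-closed _ (h zero)) (linearCombination-closed (tail a) (h ∘ suc))

    -ᴹ-closed : ∀ {x} → x ∈ S → (-ᴹ x) ∈ S
    -ᴹ-closed {x} h = resp
      (LeftModuleProperties.inverseˡ-uniqueᴹ V _ x
        (≈ᴹ-trans (+ᴹ-congˡ (≈ᴹ-sym (*ₗ-identityˡ x)))
          (≈ᴹ-trans (≈ᴹ-sym (*ₗ-distribʳ x (R.- 1#) 1#))
            (≈ᴹ-trans (*ₗ-congʳ (R.-‿inverseˡ 1#)) (*ₗ-zeroˡ x)))))
      (*ₗ-closed (R.- 1#) h)

  SpanOf-isSubspace : ∀ {n} (w : Vector Carrierᴹ n) → IsSubspace (SpanOf w)
  SpanOf-isSubspace w = record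
    { resp      = λ { e (a , h) → a , ≈ᴹ-trans (≈ᴹ-sym e) h }
    ; 0-closed  = const 0# , ≈ᴹ-sym (linearCombination-0 w λ _ → R.refl)
    ; +-closed  = λ { (a , h) (a′ , h′) → _ , ≈ᴹ-trans (+ᴹ-cong h h′) (≈ᴹ-sym (+-homo a a′)) }
    ; *ₗ-closed = λ { s (a , h) → _ , ≈ᴹ-trans (*ₗ-congˡ h) (≈ᴹ-sym (*ₗ-homo s a)) }
    }
    where open IsLinear (linearCombination-linear w)

  ∈-SpanOf : ∀ {n} (w : Vector Carrierᴹ n) i → w i ∈ SpanOf w
  ∈-SpanOf w zero = 1# ∷ const 0# , ≈ᴹ-sym (≈ᴹ-trans
    (+ᴹ-cong (*ₗ-identityˡ _) (linearCombination-0 (tail w) λ _ → R.refl)) (+ᴹ-identityʳ _))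
  ∈-SpanOf w (suc i) = let a , h = ∈-SpanOf (tail w) i in
    0# ∷ a , ≈ᴹ-trans h (≈ᴹ-sym (≈ᴹ-trans (+ᴹ-congʳ (*ₗ-zeroˡ _)) (+ᴹ-identityˡ _)))

  linearCombination-↑ʳ : ∀ d {n} (a : Vector Scalar (d ℕ.+ n)) (w : Vector Carrierᴹ (d ℕ.+ n)) →
    (∀ i → a (i ↑ˡ n) ≈ 0#) →
    linearCombination a w ≈ᴹ linearCombination (a ∘ (d ↑ʳ_)) (w ∘ (d ↑ʳ_))
  linearCombination-↑ʳ zero    a w a≈0 = ≈ᴹ-refl
  linearCombination-↑ʳ (suc d) a w a≈0 = ≈ᴹ-trans
    (+ᴹ-cong (≈ᴹ-trans (*ₗ-congʳ (a≈0 zero)) (*ₗ-zeroˡ _)) (linearCombination-↑ʳ d (tail a) (tail w) (a≈0 ∘ suc)))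
    (+ᴹ-identityˡ _)

  module Coordinates {n} {w : Vector Carrierᴹ n} (independent : LinearlyIndependent w)
                     (generates : ∀ v → v ∈ SpanOf w) where

    coordinates : Carrierᴹ → Vector Scalar n
    coordinates v = proj₁ (generates v)

    coordinates-unique : ∀ {v a} → v ≈ᴹ linearCombination a w → ∀ i → coordinates v i ≈ a i
    coordinates-unique e = linearCombination-injective independent
      (≈ᴹ-trans (≈ᴹ-sym (proj₂ (generates _))) e)

    -- Independence makes the chosen coefficients unique, and any unique choice of coefficients
    -- respects sums and multiples.
    coordinate-linear : ∀ i → IsLinear V leftModule (λ v → coordinates v i)
    coordinate-linear i = record
      { cong    = λ e → coordinates-unique (≈ᴹ-trans e (proj₂ (generates _))) i
      ; +-homo  = λ x y → coordinates-unique
          (≈ᴹ-trans (+ᴹ-cong (proj₂ (generates x)) (proj₂ (generates y))) (≈ᴹ-sym (L.+-homo _ _))) i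
      ; *ₗ-homo = λ s x → coordinates-unique
          (≈ᴹ-trans (*ₗ-congˡ (proj₂ (generates x))) (≈ᴹ-sym (L.*ₗ-homo s _))) i
      }
      where module L = IsLinear (linearCombination-linear w)

-- Bases and linear equations in finite vector spaces.

module FiniteVectorSpace
  (F : HeytingField c ℓ₁ ℓ₂) {q : ℕ} (F-card : HasCardinality (Ring.setoid (fieldRing F)) q) (1<q : 1 < q)
  (V : LeftModule (fieldRing F) v ℓv) {N : ℕ} (V-card : HasCardinality (LeftModule.≈ᴹ-setoid V) (q ^ N))
  where

  open FiniteField F F-card
  open Ring (fieldRing F) using (_≈_; 0#; 1#) renaming (Carrier to Scalar)
  private module F = Ring (fieldRing F)
  open LeftModule V
  open LinearAlgebra V

  -- Independent vectors have q^n distinct linear combinations, while the space has only q^N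
  -- elements.
  independent⇒≤ : ∀ {n} {w : Vector Carrierᴹ n} → LinearlyIndependent w → n ≤ N
  independent⇒≤ {n} {w} independent = ℕ.≮⇒≥ λ N<n →
    let a , a′ , a≉a′ , e = pigeonhole (vector-cardinality F-card n) V-card (ℕ.^-monoʳ-< q 1<q N<n)
                              (λ a → linearCombination a w)
    in a≉a′ (linearCombination-injective V independent e)

  SpanOf? : ∀ {n} (w : Vector Carrierᴹ n) → Unary.Decidable (SpanOf V w)
  SpanOf? {n} w x = finite-any? (vector-cardinality F-card n)
    (λ e h → ≈ᴹ-trans h (IsLinear.cong (linearCombination-linear V w) e))
    (λ a → finite-≟ V-card x (linearCombination a w))

  -- A relation in which x has a nonzero coefficient could be divided by it and would place x in the
  -- span of `w`; otherwise it is a relation among `w` alone.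
  ∷-independent : ∀ {n x} {w : Vector Carrierᴹ n} → LinearlyIndependent w → ¬ x ∈ SpanOf V w →
    LinearlyIndependent (x ∷ w)
  ∷-independent {x = x} {w} independent x∉ a e with a zero ≟ 0#
  ... | yes a₀≈0 = λ where
    zero    → a₀≈0
    (suc i) → independent (tail a) (≈ᴹ-trans (≈ᴹ-sym (linearCombination-↑ʳ V 1 a (x ∷ w) λ { zero → a₀≈0 })) e) i
  ... | no  a₀≉0 = contradiction (resp
    (≈ᴹ-trans (≈ᴹ-sym (*ₗ-assoc _ _ _)) (≈ᴹ-trans (*ₗ-congʳ (proj₂ (inverse _ a₀≉0))) (*ₗ-identityˡ x)))
    (*ₗ-closed (proj₁ (inverse _ a₀≉0)) (resp
      (≈ᴹ-sym (LeftModuleProperties.inverseˡ-uniqueᴹ V _ _ e))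
      (-ᴹ-closed V (SpanOf-isSubspace V w) (tail a , ≈ᴹ-refl))))) x∉
    where open IsSubspace (SpanOf-isSubspace V w)

  -- New vectors are put in front, so the given family `w` stays at the end and is reached through
  -- `added ↑ʳ_`.
  record Extension (S : Pred Carrierᴹ p) {m n} (w : Vector Carrierᴹ m) (g : Vector Carrierᴹ n)
                   : Set (c ⊔ ℓ₁ ⊔ v ⊔ ℓv ⊔ p) where
    field
      added       : ℕ
      vectors     : Vector Carrierᴹ (added ℕ.+ m)
      extends     : ∀ i → vectors (added ↑ʳ i) ≡ w i
      contained   : ∀ i → vectors i ∈ S
      independent : LinearlyIndependent vectors
      generates   : ∀ i → g i ∈ SpanOf V vectors

  -- Greedy exchange: each generator is adjoined only if it is outside the span reached so far,
  -- which is decidable.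
  extend : {S : Pred Carrierᴹ p} → ∀ {m n} (w : Vector Carrierᴹ m) (g : Vector Carrierᴹ n) →
    (∀ i → w i ∈ S) → (∀ i → g i ∈ S) → LinearlyIndependent w → Extension S w g
  extend {n = zero} w g w∈S g∈S independent = record
    { added = 0 ; vectors = w ; extends = λ _ → ≡.refl ; contained = w∈S
    ; independent = independent ; generates = λ () }
  extend {S = S} {n = suc n} w g w∈S g∈S independent
    with extend {S = S} w (tail g) w∈S (g∈S ∘ suc) independent
  ... | E with SpanOf? (Extension.vectors E) (g zero)
  ...   | yes g₀∈ = record
    { Extension E ; generates = λ { zero → g₀∈ ; (suc i) → Extension.generates E i } }
  ...   | no  g₀∉ = record
    { added       = suc E.added
    ; vectors     = g zero ∷ E.vectors
    ; extends     = E.extends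
    ; contained   = λ { zero → g∈S zero ; (suc i) → E.contained i }
    ; independent = ∷-independent E.independent g₀∉
    ; generates   = λ where
        zero    → ∈-SpanOf V (g zero ∷ E.vectors) zero
        (suc i) → let a , e = E.generates i in
          0# ∷ a , ≈ᴹ-trans e (≈ᴹ-sym (linearCombination-↑ʳ V 1 (0# ∷ a) (g zero ∷ E.vectors) λ { zero → F.refl }))
    }
    where module E = Extension E

  elements : Vector Carrierᴹ (q ^ N)
  elements = Inverse.from V-card

  generates-elements⇒generates : ∀ {n} {w : Vector Carrierᴹ n} → (∀ i → elements i ∈ SpanOf V w) →
    ∀ x → x ∈ SpanOf V w
  generates-elements⇒generates {w = w} h x = IsSubspace.resp (SpanOf-isSubspace V w)
    (Inverse.strictlyInverseʳ V-card x) (h (Inverse.to V-card x))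

  -- A presentation of the span of `w` as the common kernel of linear forms. The bound says that,
  -- for independent `w`, their number is at most the codimension.
  record Equations {n} (w : Vector Carrierᴹ n) : Set (c ⊔ ℓ₁ ⊔ v ⊔ ℓv) where
    field
      number    : ℕ
      number+n≤ : number ℕ.+ n ≤ N
      φ         : Fin number → Carrierᴹ → Scalar
      linear    : ∀ i → IsLinear V leftModule (φ i)
      sound     : ∀ {x} → x ∈ SpanOf V w → ∀ i → φ i x ≈ 0#
      complete  : ∀ {x} → (∀ i → φ i x ≈ 0#) → x ∈ SpanOf V w

  -- Complete `w` to a basis of the whole space. The coordinates along the added vectors vanish
  -- exactly on the span of `w`.
  equations : ∀ {n} {w : Vector Carrierᴹ n} → LinearlyIndependent w → Equations w
  equations {n} {w} w-independent = record
    { number    = added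
    ; number+n≤ = independent⇒≤ independent
    ; φ         = λ i x → coordinates x (i ↑ˡ n)
    ; linear    = λ i → coordinate-linear (i ↑ˡ n)
    ; sound     = λ {x} (a , e) i → F.trans
        (coordinates-unique (≈ᴹ-trans e (≈ᴹ-sym (≈ᴹ-trans
          (linearCombination-↑ʳ V added (const 0# ++ a) vectors
            (λ i → F.reflexive (lookup-++ˡ (const 0#) a i)))
          (linearCombination-cong V (λ i → F.reflexive (lookup-++ʳ {m = added} (const 0#) a i))
                                    (λ i → ≈ᴹ-reflexive (extends i)))))) (i ↑ˡ n))
        (F.reflexive (lookup-++ˡ (const 0#) a i))
    ; complete  = λ {x} h → coordinates x ∘ (added ↑ʳ_) ,
        ≈ᴹ-trans (proj₂ (spanning x)) (≈ᴹ-trans (linearCombination-↑ʳ V added (coordinates x) vectors h)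
          (linearCombination-cong V (λ _ → F.refl) (λ i → ≈ᴹ-reflexive (extends i))))
    }
    where
    -- All elements of the space serve as generators, so the extended family is a basis of it.
    open Extension (extend {S = Unary.U} w elements (λ _ → _) (λ _ → _) w-independent)
    spanning = generates-elements⇒generates generates
    open Coordinates V independent spanning

-- The dot product and the projections of K^k onto K².

module FieldGeometry
  (K : HeytingField c ℓ₁ ℓ₂) {Q : ℕ} (K-card : HasCardinality (Ring.setoid (fieldRing K)) Q)
  where

  open FiniteField K K-card public
  private
    K-ring = fieldRing K
    K¹ = leftModule {R = K-ring}
  open Ring K-ring hiding (zero) renaming (Carrier to Scalar)
  open HeytingField K using (*-comm)
  open Sum +-commutativeMonoid using (sum-remove; sum-cong-≋)
  open LinearAlgebra

  -- In K as a module over itself, scaling is multiplication, so a linear combination is the dot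
  -- product and inherits the lemmas above.
  infix 7 _∙_
  _∙_ : ∀ {n} → Vector Scalar n → Vector Scalar n → Scalar
  _∙_ = linearCombination K¹

  ∙-comm : ∀ {n} (x y : Vector Scalar n) → x ∙ y ≈ y ∙ x
  ∙-comm x y = sum-cong-≋ λ i → *-comm (x i) (y i)

  ∙-linearˡ : ∀ {n} (y : Vector Scalar n) → IsLinear (power K¹ n) K¹ (_∙ y)
  ∙-linearˡ = linearCombination-linear K¹

  ∙-linearʳ : ∀ {n} (x : Vector Scalar n) → IsLinear (power K¹ n) K¹ (x ∙_)
  ∙-linearʳ x = record
    { cong    = λ e → linearCombination-cong K¹ (λ _ → refl) e
    ; +-homo  = λ y z → trans (∙-comm x _) (trans (L.+-homo y z) (+-cong (∙-comm y x) (∙-comm z x)))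
    ; *ₗ-homo = λ s y → trans (∙-comm x _) (trans (L.*ₗ-homo s y) (*-congˡ (∙-comm y x)))
    }
    where module L = IsLinear (∙-linearˡ x)

  IsNonzero : ∀ {n} → Vector Scalar n → Set ℓ₁
  IsNonzero x = ∃[ i ] ¬ x i ≈ 0#

  nonzero : ∀ {n} {x : Vector Scalar n} → ¬ (∀ i → x i ≈ 0#) → IsNonzero x
  nonzero {n} {x} = Fin.¬∀⟶∃¬ n (λ i → x i ≈ 0#) (λ i → x i ≟ 0#)

  *-cancelʳ-nonzero : ∀ {x y z} → ¬ z ≈ 0# → x * z ≈ y * z → x ≈ y
  *-cancelʳ-nonzero {x} {y} {z} z≉0 e = trans (sym (undo x)) (trans (*-congʳ e) (undo y))
    where
    z⁻¹ = proj₁ (inverse z z≉0)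
    undo : ∀ x → (x * z) * z⁻¹ ≈ x
    undo x = trans (*-assoc x z z⁻¹) (trans (*-congˡ (trans (*-comm z z⁻¹) (proj₂ (inverse z z≉0)))) (*-identityʳ x))

  -- All terms of the two dot products except the one at p agree and cancel; the remaining factor u
  -- p is invertible.
  ∙-determines : ∀ {n} (x y u : Vector Scalar (suc n)) {p} → ¬ u p ≈ 0# →
    (∀ i → removeAt x p i ≈ removeAt y p i) → x ∙ u ≈ y ∙ u → ∀ i → x i ≈ y i
  ∙-determines x y u {p} u≉0 rest e i with p Fin.≟ i
  ... | yes ≡.refl = *-cancelʳ-nonzero u≉0 (GroupProperties.∙-cancelʳ +-group _ _ _
    (trans (sym (sum-remove λ i → x i * u i))
      (trans e (trans (sum-remove λ i → y i * u i) (+-congˡ (sum-cong-≋ λ i → *-congʳ (sym (rest i))))))))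
  ... | no p≢i = ≡.subst (λ i → x i ≈ y i) (Fin.punchIn-punchOut p≢i) (rest (punchOut p≢i))

  -- The rows of the matrix of the projection. Its first two columns form the identity matrix, and
  -- the others carry the free parameters x and y.
  frame : ∀ {k} → Vector Scalar k → Vector Scalar k → Vector (Vector Scalar (suc (suc k))) 2
  frame x y zero       = 1# ∷ 0# ∷ x
  frame x y (suc zero) = 0# ∷ 1# ∷ y

  module _ {k} (x y : Vector Scalar k) (u : Vector Scalar (suc (suc k))) where

    private
      u′ : Vector Scalar k
      u′ = tail (tail u)

      vanish : ∀ {t} z → (∀ i → u′ i ≈ 0#) → t + z ∙ u′ ≈ t
      vanish z u′≈0 = trans (+-congˡ (trans (∙-comm z u′) (linearCombination-0 K¹ z u′≈0))) (+-identityʳ _)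

    frame-∙₀ : frame x y zero ∙ u ≈ u zero + x ∙ u′
    frame-∙₀ = +-cong (*-identityˡ _) (trans (+-congʳ (zeroˡ _)) (+-identityˡ _))

    frame-∙₁ : frame x y (suc zero) ∙ u ≈ u (suc zero) + y ∙ u′
    frame-∙₁ = trans (+-cong (zeroˡ _) (+-congʳ (*-identityˡ _))) (+-identityˡ _)

    frame-kernel : (∀ s → frame x y s ∙ u ≈ 0#) → (∀ i → u′ i ≈ 0#) → ∀ i → u i ≈ 0#
    frame-kernel xy∙u≈0 u′≈0 zero          = trans (sym (trans frame-∙₀ (vanish x u′≈0))) (xy∙u≈0 zero)
    frame-kernel xy∙u≈0 u′≈0 (suc zero)    = trans (sym (trans frame-∙₁ (vanish y u′≈0))) (xy∙u≈0 (suc zero))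
    frame-kernel xy∙u≈0 u′≈0 (suc (suc i)) = u′≈0 i

  module _ {N k} (w : Fin N → Vector Scalar (suc (suc k))) where

    -- Vectors whose tail vanishes are left out: by `frame-kernel`, such a vector is killed only if
    -- it is zero.
    Bad : Vector Scalar k × Vector Scalar k → Set ℓ₁
    Bad (x , y) = ∃[ i ] ((∀ s → frame x y s ∙ w i ≈ 0#) × IsNonzero (tail (tail (w i))))

    Bad? : Unary.Decidable Bad
    Bad? (x , y) = Fin.any? λ i →
      Fin.all? (λ s → frame x y s ∙ w i ≟ 0#) ×-dec Fin.any? (λ j → ¬? (tail (tail (w i)) j ≟ 0#))

    Bad-resp : ∀ {x x′ y y′} → (∀ i → x i ≈ x′ i) → (∀ i → y i ≈ y′ i) → Bad (x , y) → Bad (x′ , y′)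
    Bad-resp {x} {x′} {y} {y′} ex ey (i , h , nz) =
      i , (λ s → trans (sym (IsLinear.cong (∙-linearˡ (w i)) (frame-cong s))) (h s)) , nz
      where
      frame-cong : ∀ s j → frame x y s j ≈ frame x′ y′ s j
      frame-cong zero       zero          = refl
      frame-cong zero       (suc zero)    = refl
      frame-cong zero       (suc (suc j)) = ex j
      frame-cong (suc zero) zero          = refl
      frame-cong (suc zero) (suc zero)    = refl
      frame-cong (suc zero) (suc (suc j)) = ey j

-- Counting projections: one that kills no nonzero member of a small family.

module SeparatingFrame
  (K : HeytingField c ℓ₁ ℓ₂) {Q : ℕ} (K-card : HasCardinality (Ring.setoid (fieldRing K)) Q)
  where

  open FieldGeometry K K-card
  open Ring (fieldRing K) hiding (zero) renaming (Carrier to Scalar; setoid to K-setoid)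

  private
    pairs : ℕ → Setoid c ℓ₁
    pairs k = ×-setoid (≋-setoid K-setoid k) (≋-setoid K-setoid k)

    pairs-card : ∀ k → HasCardinality (pairs k) (Q ^ k ℕ.* Q ^ k)
    pairs-card k = ×-cardinality (vector-cardinality K-card k) (vector-cardinality K-card k)

  -- If every pair (x , y) were bad, then dropping the coordinates of x and y at
  -- a pivot of a vector w i killed by the pair would lose no information.
  ∃-¬Bad : ∀ {N k} → N < Q ℕ.* Q → (w : Fin N → Vector Scalar (suc (suc k))) → ∃[ xy ] ¬ Bad w xy
  ∃-¬Bad {N} {zero}  N<Q² w = ([] , []) , λ { (_ , _ , () , _) }
  ∃-¬Bad {N} {suc k} N<Q² w = decidable-stable
    (finite-any? (pairs-card (suc k))
      (λ (ex , ey) ¬bad → ¬bad ∘ Bad-resp w (sym ∘ ex) (sym ∘ ey)) (λ xy → ¬? (Bad? w xy)))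
    (λ none → notAllBad λ xy → decidable-stable (Bad? w xy) λ ¬bad → none (xy , ¬bad))
    where
    pivot? : ∀ i → Dec (IsNonzero (tail (tail (w i))))
    pivot? i = Fin.any? (λ j → ¬? (tail (tail (w i)) j ≟ 0#))

    -- The pivot depends on i alone, so two pairs with the same index in their codes have lost the
    -- same coordinate. The value `zero` for a vanishing tail is a dummy.
    pivot : Fin N → Fin (suc k)
    pivot i with pivot? i
    ... | yes (p , _) = p
    ... | no _        = zero

    pivot-nonzero : ∀ i → IsNonzero (tail (tail (w i))) → ¬ tail (tail (w i)) (pivot i) ≈ 0#
    pivot-nonzero i nz with pivot? i
    ... | yes (_ , p≉0) = p≉0
    ... | no ¬nz        = contradiction nz ¬nz

    code : (∀ xy → Bad w xy) → Vector Scalar (suc k) × Vector Scalar (suc k) →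
           Fin N × Vector Scalar k × Vector Scalar k
    code bad (x , y) = let i = proj₁ (bad (x , y)) in i , removeAt x (pivot i) , removeAt y (pivot i)

    -- Both pairs kill the same `w i`, so x and x′ have the same dot product with its tail, and
    -- likewise y and y′. This restores the coordinate dropped at the pivot.
    decode : ∀ {x y x′ y′} (bad : Bad w (x , y)) (bad′ : Bad w (x′ , y′)) → proj₁ bad ≡ proj₁ bad′ →
      (∀ j → removeAt x (pivot (proj₁ bad)) j ≈ removeAt x′ (pivot (proj₁ bad′)) j) →
      (∀ j → removeAt y (pivot (proj₁ bad)) j ≈ removeAt y′ (pivot (proj₁ bad′)) j) →
      (∀ j → x j ≈ x′ j) × (∀ j → y j ≈ y′ j)
    decode {x} {y} {x′} {y′} (i , h , nz) (_ , h′ , _) ≡.refl ex ey =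
      ∙-determines x x′ (tail (tail (w i))) (pivot-nonzero i nz) ex (GroupProperties.∙-cancelˡ +-group _ _ _
        (trans (sym (frame-∙₀ x y (w i))) (trans (h zero) (trans (sym (h′ zero)) (frame-∙₀ x′ y′ (w i)))))) ,
      ∙-determines y y′ (tail (tail (w i))) (pivot-nonzero i nz) ey (GroupProperties.∙-cancelˡ +-group _ _ _
        (trans (sym (frame-∙₁ x y (w i))) (trans (h (suc zero)) (trans (sym (h′ (suc zero))) (frame-∙₁ x′ y′ (w i))))))

    size : N ℕ.* (Q ^ k ℕ.* Q ^ k) < Q ^ suc k ℕ.* Q ^ suc k
    size = ≡.subst (N ℕ.* (Q ^ k ℕ.* Q ^ k) <_) (ℕ.[m*n]*[o*p]≡[m*o]*[n*p] Q Q (Q ^ k) (Q ^ k))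
      (ℕ.*-monoˡ-< _ {{ℕ.m*n≢0 (Q ^ k) (Q ^ k)}} N<Q²)
      where instance
        Q≢0 = Fin.nonZeroIndex (Inverse.to K-card 0#)
        Q^k≢0 = ℕ.m^n≢0 Q k

    notAllBad : ¬ (∀ xy → Bad w xy)
    notAllBad bad = ℕ.<⇒≱ size (injective⇒≤ {A = pairs (suc k)} {B = ×-setoid (setoid (Fin N)) (pairs k)}
      (pairs-card (suc k)) (×-cardinality (fin-cardinality N) (pairs-card k)) (code bad)
      λ {xy} {xy′} (e , ex , ey) → decode (bad xy) (bad xy′) e ex ey)

  -- For a pair that is not bad, a killed `w i` has vanishing tail, and then `frame-kernel` applies.
  separatingFrame : ∀ {N k} → N < Q ℕ.* Q → (w : Fin N → Vector Scalar (suc (suc k))) →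
    ∃[ x ] ∃[ y ] (∀ i → (∀ s → frame x y s ∙ w i ≈ 0#) → ∀ j → w i j ≈ 0#)
  separatingFrame N<Q² w = let (x , y) , ¬bad = ∃-¬Bad N<Q² w in
    x , y , λ i h → frame-kernel x y (w i) h λ j →
      decidable-stable (tail (tail (w i)) j ≟ 0#) λ nz → ¬bad (i , h , j , nz)

-- Hyperplanes as kernels of linear forms, and lines in the plane.

module Hyperplanes
  (K : HeytingField c ℓ₁ ℓ₂) {Q : ℕ} (K-card : HasCardinality (Ring.setoid (fieldRing K)) Q)
  where

  open FieldGeometry K K-card
  open Ring (fieldRing K) hiding (zero) renaming (Carrier to Scalar)
  open HeytingField K using (*-comm)
  open Sum +-commutativeMonoid using (sum-remove; sum-cong-≋)
  open LinearAlgebra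
  private
    K¹ = leftModule {R = fieldRing K}
    K^ = power K¹

  *-swap : ∀ x y z → x * (y * z) ≈ y * (x * z)
  *-swap x y z = trans (sym (*-assoc x y z)) (trans (*-congʳ (*-comm x y)) (*-assoc y x z))

  unit : ∀ {n} → Fin n → Vector Scalar n
  unit zero    = 1# ∷ const 0#
  unit (suc i) = 0# ∷ unit i

  ∙-unit : ∀ {n} (a : Vector Scalar n) j → a ∙ (λ i → unit i j) ≈ a j
  ∙-unit {suc n} a zero = trans
    (+-cong (*-identityʳ _) (trans (∙-comm (tail a) (const 0#)) (linearCombination-0 K¹ (tail a) λ _ → refl)))
    (+-identityʳ _)
  ∙-unit {suc n} a (suc j) = trans (+-cong (zeroʳ _) (∙-unit (tail a) j)) (+-identityˡ _)

  lookup-linear : ∀ {n} i → IsLinear (K^ n) K¹ (λ x → x i)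
  lookup-linear i = record { cong = λ e → e i ; +-homo = λ _ _ → refl ; *ₗ-homo = λ _ _ → refl }

  linearCombination-lookup : ∀ {n k} (a : Vector Scalar n) (w : Vector (Vector Scalar k) n) j →
    linearCombination (K^ k) a w j ≈ a ∙ (λ i → w i j)
  linearCombination-lookup a w j = linearCombination-homo (lookup-linear j) a w

  linearCombination-∙ : ∀ {n k} (a : Vector Scalar n) (w : Vector (Vector Scalar k) n) (u : Vector Scalar k) →
    linearCombination (K^ k) a w ∙ u ≈ a ∙ (λ i → w i ∙ u)
  linearCombination-∙ a w u = linearCombination-homo (∙-linearˡ u) a w

  -- The `Lift` brings the predicate to the level `c ⊔ ℓ₁` that `Is2Spannable` asks of hyperplanes.
  Kernel : ∀ {n} → Vector Scalar n → Pred (Vector Scalar n) (c ⊔ ℓ₁)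
  Kernel h x = Lift c (h ∙ x ≈ 0#)

  Kernel-isSubspace : ∀ {n} (h : Vector Scalar n) → IsSubspace (K^ n) (Kernel h)
  Kernel-isSubspace h = record
    { resp      = λ e (lift x∈) → lift (trans (sym (L.cong e)) x∈)
    ; 0-closed  = lift (0-homo (∙-linearʳ h))
    ; +-closed  = λ (lift x∈) (lift y∈) → lift (trans (L.+-homo _ _) (trans (+-cong x∈ y∈) (+-identityˡ 0#)))
    ; *ₗ-closed = λ s (lift x∈) → lift (trans (L.*ₗ-homo s _) (trans (*-congˡ x∈) (zeroʳ s)))
    }
    where module L = IsLinear (∙-linearʳ h)

  insertAt-linear : ∀ {v ℓv} {V : LeftModule (fieldRing K) v ℓv} {n} (f : LeftModule.Carrierᴹ V → Vector Scalar n)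
    {s : LeftModule.Carrierᴹ V → Scalar} → (∀ i → IsLinear V K¹ (λ x → f x i)) → IsLinear V K¹ s →
    ∀ p j → IsLinear V K¹ (λ x → insertAt (f x) p (s x) j)
  insertAt-linear             f F S zero    zero    = S
  insertAt-linear             f F S zero    (suc j) = F j
  insertAt-linear {n = suc n} f F S (suc p) zero    = F zero
  insertAt-linear {n = suc n} f F S (suc p) (suc j) = insertAt-linear (tail ∘ f) (F ∘ suc) S p j

  insertAt-congʳ : ∀ {n} (x : Vector Scalar n) p {s t} → s ≈ t → ∀ j → insertAt x p s j ≈ insertAt x p t j
  insertAt-congʳ         x zero    e zero    = e
  insertAt-congʳ         x zero    e (suc j) = refl
  insertAt-congʳ {suc n} x (suc p) e zero    = refl
  insertAt-congʳ {suc n} x (suc p) e (suc j) = insertAt-congʳ (tail x) p e j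

  module _ {n} (h : Vector Scalar (suc n)) {p} (h-p≉0 : ¬ h p ≈ 0#) where

    private
      h′ : Vector Scalar n
      h′ = removeAt h p

      -- The value at position p that puts a vector with remaining coordinates a into the kernel of
      -- h.
      solve : Vector Scalar n → Scalar
      solve a = - proj₁ (inverse _ h-p≉0) * (h′ ∙ a)

      solve-linear : IsLinear (K^ n) K¹ solve
      solve-linear = record
        { cong    = λ e → *-congˡ (L.cong e)
        ; +-homo  = λ x y → trans (*-congˡ (L.+-homo x y)) (distribˡ _ _ _)
        ; *ₗ-homo = λ s x → trans (*-congˡ (L.*ₗ-homo s x)) (*-swap _ s _)
        }
        where module L = IsLinear (∙-linearʳ h′)

      solve-spec : ∀ a → h p * solve a ≈ - (h′ ∙ a)
      solve-spec a = trans (sym (*-assoc _ _ _)) (trans (*-congʳ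
        (trans (*-comm _ _) (trans (sym (-‿distribˡ-* _ _)) (-‿cong (proj₂ (inverse _ h-p≉0))))))
        (-1*x≈-x _))
        where open import Algebra.Properties.Ring (fieldRing K) using (-‿distribˡ-*; -1*x≈-x)

      parametrize : Vector Scalar n → Vector Scalar (suc n)
      parametrize a = insertAt a p (solve a)

      parametrize-linear : IsLinear (K^ n) (K^ (suc n)) parametrize
      parametrize-linear = record
        { cong    = λ e i → IsLinear.cong (L i) e
        ; +-homo  = λ x y i → IsLinear.+-homo (L i) x y
        ; *ₗ-homo = λ s x i → IsLinear.*ₗ-homo (L i) s x
        }
        where L = insertAt-linear (λ a → a) lookup-linear solve-linear p

      ∙-parametrize : ∀ a → h ∙ parametrize a ≈ 0#
      ∙-parametrize a = trans (sum-remove {i = p} (λ i → h i * parametrize a i)) (trans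
        (+-cong (trans (*-congˡ (reflexive (insertAt-lookup a p _))) (solve-spec a))
                (sum-cong-≋ λ i → *-congˡ (reflexive (insertAt-punchIn a p _ i))))
        (-‿inverseˡ _))

      linearCombination-basis : ∀ a i → linearCombination (K^ (suc n)) a (parametrize ∘ unit) i ≈ parametrize a i
      linearCombination-basis a i = trans
        (sym (linearCombination-homo parametrize-linear a unit i))
        (IsLinear.cong parametrize-linear (λ j → trans (linearCombination-lookup a unit j) (∙-unit a j)) i)

    -- The linear map `parametrize` identifies K^n with the kernel, its inverse being the removal of
    -- coordinate p. The images of the unit vectors are therefore a basis.
    Kernel-dimension : HasDimension (K^ (suc n)) (Kernel h) n
    Kernel-dimension = parametrize ∘ unit , record
      { contained   = λ i → lift (∙-parametrize (unit i))
      ; independent = λ a e i → trans (reflexive (≡.sym (insertAt-punchIn a p _ i)))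
          (trans (sym (linearCombination-basis a (punchIn p i))) (e (punchIn p i)))
      -- The equation h ∙ x = 0 forces the coordinate at p to be the solved one.
      ; generates   = λ {x} (lift x∈) → removeAt x p , λ i →
          trans (reflexive (≡.sym (insertAt-removeAt x p i)))
            (trans (insertAt-congʳ (removeAt x p) p (*-cancelʳ-nonzero h-p≉0
              (trans (*-comm _ _) (trans
                (GroupProperties.inverseˡ-unique +-group _ _
                  (trans (sym (sum-remove {i = p} (λ i → h i * x i))) x∈))
                (trans (sym (solve-spec (removeAt x p))) (*-comm _ _))))) i)
              (sym (linearCombination-basis (removeAt x p) i)))
      }

  -- The form y ↦ det (y , p), whose kernel is the line through p when p is nonzero.
  normal : Vector Scalar 2 → Vector Scalar 2
  normal p = p (suc zero) ∷ - p zero ∷ []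

  -- A vanishing determinant gives yⱼ pᵢ = yᵢ pⱼ for all i and j; dividing by a nonzero pᵢ yields t
  -- = yᵢ / pᵢ.
  normal-∙ : ∀ p y → normal p ∙ y ≈ 0# → IsNonzero p → ∃[ t ] (∀ i → y i ≈ t * p i)
  normal-∙ p y e (i , pᵢ≉0) = y i * pᵢ⁻¹ , λ j → *-cancelʳ-nonzero pᵢ≉0 (trans (cross j i)
    (trans (*-congʳ (sym (trans (*-assoc _ _ _) (trans (*-congˡ (proj₂ (inverse _ pᵢ≉0))) (*-identityʳ _)))))
      (trans (*-assoc _ _ _) (trans (*-congˡ (*-comm _ _)) (sym (*-assoc _ _ _))))))
    where
    open import Algebra.Properties.Ring (fieldRing K) using (-‿distribˡ-*; -‿involutive)
    pᵢ⁻¹ = proj₁ (inverse _ pᵢ≉0)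
    e′ : p (suc zero) * y zero ≈ p zero * y (suc zero)
    e′ = trans (GroupProperties.inverseˡ-unique +-group _ _ (trans (sym (+-congˡ (+-identityʳ _))) e))
      (trans (-‿cong (sym (-‿distribˡ-* _ _))) (-‿involutive _))
    cross : ∀ j i → y j * p i ≈ y i * p j
    cross zero       zero       = refl
    cross zero       (suc zero) = trans (*-comm _ _) (trans e′ (*-comm _ _))
    cross (suc zero) zero       = trans (*-comm _ _) (trans (sym e′) (*-comm _ _))
    cross (suc zero) (suc zero) = refl

  normal-nonzero : ∀ p → IsNonzero p → IsNonzero (normal p)
  normal-nonzero p (zero , p₀≉0)     = suc zero , λ e → p₀≉0
    (trans (sym (GroupProperties.⁻¹-involutive +-group _)) (trans (-‿cong e) (GroupProperties.ε⁻¹≈ε +-group)))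
  normal-nonzero p (suc zero , p₁≉0) = zero , p₁≉0

  normal-∙-multiple : ∀ p s → normal p ∙ (λ i → s * p i) ≈ 0#
  normal-∙-multiple p s = trans (IsLinear.*ₗ-homo (∙-linearʳ (normal p)) s p) (trans (*-congˡ
    (trans (+-cong (*-comm _ _) (trans (+-identityʳ _) (sym (-‿distribˡ-* _ _)))) (-‿inverseʳ _))) (zeroʳ s))
    where open import Algebra.Properties.Ring (fieldRing K) using (-‿distribˡ-*)

  -- A form that is nonzero at p takes every value on the line through p; here s = (g ∙ z) / (g ∙
  -- p).
  onLine : ∀ {n} (g p : Vector Scalar n) → ¬ g ∙ p ≈ 0# → ∀ z → ∃[ s ] g ∙ (λ i → s * p i) ≈ g ∙ z
  onLine g p g∙p≉0 z = (g ∙ z) * proj₁ (inverse _ g∙p≉0) ,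
    trans (IsLinear.*ₗ-homo (∙-linearʳ g) _ p)
      (trans (*-assoc _ _ _) (trans (*-congˡ (proj₂ (inverse _ g∙p≉0))) (*-identityʳ _)))

  x-y+y≈x : ∀ x y → (x - y) + y ≈ x
  x-y+y≈x x y = trans (+-assoc _ _ _) (trans (+-congˡ (-‿inverseˡ y)) (+-identityʳ x))

-- Restriction of scalars, and F-linear forms on K².

module _ {R : Ring r ℓr} {S : Ring u ℓ} {ι : Ring.Carrier R → Ring.Carrier S}
         (ι-hom : RingMorphisms.IsRingHomomorphism (Ring.rawRing R) (Ring.rawRing S) ι)
         {V : LeftModule S v ℓv} {W : LeftModule S w ℓw} where

  restrictScalars-linear : ∀ {f} → IsLinear V W f →
    IsLinear (restrictScalars {R = R} ι-hom V) (restrictScalars {R = R} ι-hom W) f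
  restrictScalars-linear linear = record { cong = cong ; +-homo = +-homo ; *ₗ-homo = *ₗ-homo ∘ ι }
    where open IsLinear linear

module FieldExtension {q m : ℕ} (E : FiniteFieldExtension q m c ℓ₁ ℓ₂) (1<q : 1 < q) (1≤m : 1 ≤ m) where

  open FiniteFieldExtension E
  open FieldGeometry K K-card
  open Hyperplanes K K-card
  open Ring K-ring hiding (zero) renaming (Carrier to Scalar)
  private
    module F = Ring F-ring
    F¹ = leftModule {R = F-ring}
    K¹ = leftModule {R = K-ring}
    K¹-over-F : LeftModule F-ring c ℓ₁
    K¹-over-F = restrictScalars ι-hom K¹
    K²-over-F = K^k-over-F E 2

  K²-cardinality : HasCardinality (LeftModule.≈ᴹ-setoid K²-over-F) (q ^ (m ℕ.* 2))
  K²-cardinality = ≡.subst (HasCardinality _) (ℕ.^-*-assoc q m 2) (vector-cardinality K-card 2)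

  -- Extending the empty family by all elements gives an F-basis of K, and K has q^m elements.
  generators : ∃[ d ] d ≤ m × Σ[ e ∈ Vector Scalar d ] (∀ t → t ∈ SpanOf K¹-over-F e)
  generators = _ , K.independent⇒≤ independent , vectors , K.generates-elements⇒generates generates
    where
    module K = FiniteVectorSpace F F-card 1<q K¹-over-F {m} K-card
    extension = K.extend {S = Unary.U} [] K.elements (λ _ → _) (λ _ → _) λ _ _ ()
    open K.Extension extension

  multiples-linear : (p : Vector Scalar 2) → IsLinear K¹-over-F K²-over-F (λ t i → t * p i)
  multiples-linear p = record
    { cong    = λ e i → *-congʳ e
    ; +-homo  = λ x y i → distribʳ _ _ _
    ; *ₗ-homo = λ s x i → *-assoc _ _ _
    }

  dilation-linear : ∀ s → IsLinear K²-over-F K²-over-F (λ z i → s * z i)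
  dilation-linear s = record
    { cong    = λ e i → *-congˡ (e i)
    ; +-homo  = λ x y i → distribˡ _ _ _
    ; *ₗ-homo = λ a x i → *-swap s (ι a) (x i)
    }

  -- With e an F-basis of K, the map z ↦ (φ (eᵢ z))ᵢ from K² to F^d is not injective. The difference
  -- p of two colliding vectors satisfies φ (eᵢ p) = 0 for all i, hence φ (t p) = 0 for all t in K.
  vanishingLine : ∀ {φ} → IsLinear K²-over-F F¹ φ →
    Σ[ p ∈ Vector Scalar 2 ] IsNonzero p × (∀ t → φ (λ i → t * p i) F.≈ F.0#)
  vanishingLine {φ} linear = z-z′ , z-z′-nonzero , λ t →
    let a , t≈ = e-generates t in
    F.trans (IsLinear.cong (φ-multiples z-z′) t≈)
      (F.trans (linearCombination-homo (φ-multiples z-z′) a e) (linearCombination-0ʳ F¹ a φ[eᵢ[z-z′]]≈0))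
    where
    d = proj₁ generators
    d≤m = proj₁ (proj₂ generators)
    e = proj₁ (proj₂ (proj₂ generators))
    e-generates = proj₂ (proj₂ (proj₂ generators))

    φ-multiples : (p : Vector Scalar 2) → IsLinear K¹-over-F F¹ (λ t → φ (λ i → t * p i))
    φ-multiples p = ∘-linear linear (multiples-linear p)

    collision = pigeonhole K²-cardinality (vector-cardinality F-card d)
      -- Since m ≥ 1, d ≤ m < 2m, so the target F^d is smaller than K².
      (ℕ.^-monoʳ-< q 1<q (ℕ.≤-<-trans d≤m (ℕ.m<m*n m 2 {{ℕ.>-nonZero 1≤m}} (s≤s (s≤s z≤n)))))
      (λ z i → φ (λ j → e i * z j))
    z  = proj₁ collision
    z′ = proj₁ (proj₂ collision)

    z-z′ : Vector Scalar 2
    z-z′ i = z i - z′ i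

    z-z′-nonzero : IsNonzero z-z′
    z-z′-nonzero = nonzero λ z-z′≈0 → proj₁ (proj₂ (proj₂ collision)) λ i →
      GroupProperties.x∙y⁻¹≈ε⇒x≈y +-group _ _ (z-z′≈0 i)

    φ[eᵢ[z-z′]]≈0 : ∀ i → φ (λ j → e i * z-z′ j) F.≈ F.0#
    φ[eᵢ[z-z′]]≈0 i = F.trans (φ[eᵢ-].+-homo z (λ j → - z′ j))
      (F.trans (F.+-cong (proj₂ (proj₂ (proj₂ collision)) i) (-ᴹ-homo φ[eᵢ-] z′)) (F.-‿inverseʳ _))
      where
      φ[eᵢ-] : IsLinear K²-over-F F¹ (λ z → φ (λ j → e i * z j))
      φ[eᵢ-] = ∘-linear linear (dilation-linear (e i))
      module φ[eᵢ-] = IsLinear φ[eᵢ-]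

  -- In part, y is the component of z in ker g₂ and z − y the one in ker g₁.
  record Splitting {ℓ} (V : Pred (Vector Scalar 2) ℓ) : Set (c ⊔ ℓ₁ ⊔ ℓ) where
    field
      g₁ g₂      : Vector Scalar 2
      g₁-nonzero : IsNonzero g₁
      g₂-nonzero : IsNonzero g₂
      part       : ∀ {z} → z ∈ V → ∃[ y ] y ∈ V × g₁ ∙ y ≈ g₁ ∙ z × g₂ ∙ y ≈ 0#

  Splitting-resp : ∀ {ℓ ℓ′} {V : Pred (Vector Scalar 2) ℓ} {V′ : Pred (Vector Scalar 2) ℓ′} →
    (∀ {z} → z ∈ V → z ∈ V′) → (∀ {z} → z ∈ V′ → z ∈ V) → Splitting V → Splitting V′
  Splitting-resp to from S = record
    { Splitting S ; part = λ z∈ → let y , y∈ , e = Splitting.part S (from z∈) in y , to y∈ , e }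

  module _ {φ₁ φ₂} (lin₁ : IsLinear K²-over-F F¹ φ₁) (lin₂ : IsLinear K²-over-F F¹ φ₂) where

    private
      V : Pred (Vector Scalar 2) ℓ₁
      V z = φ₁ z F.≈ F.0# × φ₂ z F.≈ F.0#

    module _ {p₁ p₂ : Vector Scalar 2} (p₁≉0 : IsNonzero p₁) (p₂≉0 : IsNonzero p₂)
             (φ₁p₁≈0 : ∀ t → φ₁ (λ i → t * p₁ i) F.≈ F.0#)
             (φ₂p₂≈0 : ∀ t → φ₂ (λ i → t * p₂ i) F.≈ F.0#) where

      -- Let y be the component of z on the line of p₂. There φ₂ vanishes; y - z lies on the line of
      -- p₁, so φ₁ y = φ₁ z = 0. Hence y stays in the common kernel.
      splitAlongDistinctLines : ¬ normal p₁ ∙ p₂ ≈ 0# → Splitting V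
      splitAlongDistinctLines g₁∙p₂≉0 = record
        { g₁ = normal p₁ ; g₂ = normal p₂
        ; g₁-nonzero = normal-nonzero p₁ p₁≉0 ; g₂-nonzero = normal-nonzero p₂ p₂≉0
        ; part = λ {z} (φ₁z≈0 , _) →
            let s , e = onLine (normal p₁) p₂ g₁∙p₂≉0 z
            in (λ i → s * p₂ i) , (φ₁≈0 z (λ i → s * p₂ i) φ₁z≈0 e , φ₂p₂≈0 s) , e , normal-∙-multiple p₂ s
        }
        where
        module g = IsLinear (∙-linearʳ (normal p₁))
        φ₁≈0 : ∀ z y → φ₁ z F.≈ F.0# → normal p₁ ∙ y ≈ normal p₁ ∙ z → φ₁ y F.≈ F.0#
        φ₁≈0 z y φ₁z≈0 e = F.trans
          (IsLinear.cong lin₁ λ i → trans (sym (x-y+y≈x (y i) (z i))) (+-congʳ (proj₂ y-z∈ i)))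
          (F.trans (IsLinear.+-homo lin₁ (λ i → proj₁ y-z∈ * p₁ i) z)
            (F.trans (F.+-cong (φ₁p₁≈0 (proj₁ y-z∈)) φ₁z≈0) (F.+-identityˡ _)))
          where
          y-z∈ = normal-∙ p₁ (λ i → y i - z i)
            (trans (g.+-homo y (λ i → - z i))
              (trans (+-cong e (-ᴹ-homo (∙-linearʳ (normal p₁)) z)) (-‿inverseʳ _))) p₁≉0

      -- Both forms vanish on the line of p₂, which thus lies in the common kernel. Any g with g ∙
      -- p₂ nonzero then gives a complementary line, and the component of z on the line of p₂ is
      -- automatically in the kernel.
      splitAlongLine : normal p₁ ∙ p₂ ≈ 0# → Splitting V
      splitAlongLine g₁∙p₂≈0 = record
        { g₁ = g ; g₂ = normal p₂
        ; g₁-nonzero = nonzero λ g≈0 → g∙p₂≉0 (linearCombination-0 K¹ p₂ g≈0)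
        ; g₂-nonzero = normal-nonzero p₂ p₂≉0
        ; part = λ {z} _ →
            let s , e = onLine g p₂ g∙p₂≉0 z
            in (λ i → s * p₂ i) , (φ₁p₂≈0 s , φ₂p₂≈0 s) , e , normal-∙-multiple p₂ s
        }
        where
        p₂∈ = normal-∙ p₁ p₂ g₁∙p₂≈0 p₁≉0
        φ₁p₂≈0 : ∀ s → φ₁ (λ i → s * p₂ i) F.≈ F.0#
        φ₁p₂≈0 s = F.trans (IsLinear.cong lin₁ λ i → trans (*-congˡ (proj₂ p₂∈ i)) (sym (*-assoc s _ _)))
          (φ₁p₁≈0 (s * proj₁ p₂∈))
        -- The coefficients that express a nonzero coordinate of p₂ are the form reading off that
        -- coordinate.
        g = proj₁ (∈-SpanOf K¹ p₂ (proj₁ p₂≉0))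
        g∙p₂≉0 : ¬ g ∙ p₂ ≈ 0#
        g∙p₂≉0 e = proj₂ p₂≉0 (trans (proj₂ (∈-SpanOf K¹ p₂ (proj₁ p₂≉0))) e)

    splitPair : Splitting V
    splitPair =
      let p₁ , p₁≉0 , φ₁p₁≈0 = vanishingLine lin₁
          p₂ , p₂≉0 , φ₂p₂≈0 = vanishingLine lin₂
      in [ splitAlongLine p₁≉0 p₂≉0 φ₁p₁≈0 φ₂p₂≈0
                       , splitAlongDistinctLines p₁≉0 p₂≉0 φ₁p₁≈0 φ₂p₂≈0 ]′
                       (toSum (normal p₁ ∙ p₂ ≟ 0#))

  -- Fewer than two forms are padded to a pair, by zero forms or by repetition, without changing the
  -- common kernel.
  split : ∀ {d} → d ≤ 2 → (φ : Fin d → Vector Scalar 2 → F.Carrier) →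
    (∀ i → IsLinear K²-over-F F¹ (φ i)) →
    Splitting (λ z → ∀ i → φ i z F.≈ F.0#)
  split {0} _ φ linear = Splitting-resp (λ _ ()) (λ _ → F.refl , F.refl) (splitPair 0-linear 0-linear)
    where
    0-linear : IsLinear K²-over-F F¹ (λ _ → F.0#)
    0-linear = record
      { cong = λ _ → F.refl ; +-homo = λ _ _ → F.sym (F.+-identityˡ _) ; *ₗ-homo = λ s _ → F.sym (F.zeroʳ s) }
  split {1} _ φ linear = Splitting-resp (λ { (h , _) zero → h }) (λ h → h zero , h zero)
    (splitPair (linear zero) (linear zero))
  split {2} _ φ linear = Splitting-resp (λ { (h , _) zero → h ; (_ , h) (suc zero) → h })
    (λ h → h zero , h (suc zero))
    (splitPair (linear zero) (linear (suc zero)))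
  split {suc (suc (suc _))} (s≤s (s≤s ()))

-- Systems: projection to K² and lifting of the splitting.

module _ {R : Ring r ℓr} (V : LeftModule R v ℓv) where

  SpanOf-⊆ : ∀ {m n} {w : Vector (LeftModule.Carrierᴹ V) m} {w′ : Vector (LeftModule.Carrierᴹ V) n} →
    (∀ i → w i ∈ SpanOf V w′) → ∀ {x} → x ∈ SpanOf V w → x ∈ SpanOf V w′
  SpanOf-⊆ {w′ = w′} h (a , e) =
    resp (LeftModule.≈ᴹ-sym V e) (linearCombination-closed V (SpanOf-isSubspace V w′) a h)
    where open LinearAlgebra.IsSubspace (SpanOf-isSubspace V w′)

module System {q m′ : ℕ} (E : FiniteFieldExtension q (suc m′) c ℓ₁ ℓ₂) (1<q : 1 < q) (k′ : ℕ) where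

  private
    m k : ℕ
    m = suc m′
    k = suc (suc k′)

  open FieldExtension E 1<q (s≤s z≤n)
  open FiniteFieldExtension E
  open FieldGeometry K K-card
  open SeparatingFrame K K-card
  open Hyperplanes K K-card
  open Ring K-ring hiding (zero) renaming (Carrier to Scalar)
  private
    module F = Ring F-ring
    Kᵏ = K^k-over-F E k
    K² = K^k-over-F E 2
    module Kᵏ = LeftModule Kᵏ
    module K² = LeftModule K²
    module 𝔽ᵏ = LinearAlgebra Kᵏ
    module 𝔽² = LinearAlgebra K²
  open FiniteVectorSpace F F-card 1<q K² {m ℕ.* 2} K²-cardinality
    using (Extension; extend; Equations; equations)

  projection : Vector (Vector Scalar k) 2 → Vector Scalar k → Vector Scalar 2
  projection X u s = X s ∙ u

  projection-linear : ∀ X → IsLinear Kᵏ K² (projection X)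
  projection-linear X = restrictScalars-linear {R = F-ring} {S = K-ring} ι-hom
    {V = K^k E k} {W = K^k E 2} (record
    { cong    = λ e s → IsLinear.cong (∙-linearʳ (X s)) e
    ; +-homo  = λ x y s → IsLinear.+-homo (∙-linearʳ (X s)) x y
    ; *ₗ-homo = λ a x s → IsLinear.*ₗ-homo (∙-linearʳ (X s)) a x
    })

  -- The F-span of `b` has q^(2m-2) elements, fewer than |K|², so one projection kills no nonzero
  -- element of it. A relation among the projected vectors is then a relation among `b`.
  injectiveFrame : (b : Vector Kᵏ.Carrierᴹ (m′ ℕ.* 2)) → 𝔽ᵏ.LinearlyIndependent b →
    ∃[ x ] ∃[ y ] 𝔽².LinearlyIndependent (projection (frame x y) ∘ b)
  injectiveFrame b independent = x , y , λ a e → independent a λ j →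
    trans (combination-code a j) (separated (to a) (λ s →
      trans (IsLinear.cong (∙-linearʳ (frame x y s)) (λ j → sym (combination-code a j)))
        (trans (linearCombination-homo (projection-linear (frame x y)) a b s) (e s))) j)
    where
    coefficients = vector-cardinality F-card (m′ ℕ.* 2)
    open Inverse coefficients using (to; from; strictlyInverseʳ)

    combinations : Fin (q ^ (m′ ℕ.* 2)) → Vector Scalar k
    combinations i = 𝔽ᵏ.linearCombination (from i) b

    combination-code : ∀ a j → 𝔽ᵏ.linearCombination a b j ≈ combinations (to a) j
    combination-code a = IsLinear.cong (linearCombination-linear Kᵏ b) (λ i → F.sym (strictlyInverseʳ a i))

    few : q ^ (m′ ℕ.* 2) < q ^ m ℕ.* q ^ m
    few = ≡.subst (q ^ (m′ ℕ.* 2) <_)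
      (≡.trans (≡.cong (q ^_) (≡.trans (ℕ.*-comm m 2) (≡.cong (m ℕ.+_) (ℕ.+-identityʳ m))))
        (ℕ.^-distribˡ-+-* q m m))
      (ℕ.^-monoʳ-< q 1<q (ℕ.m<n⇒m<1+n (ℕ.n<1+n (m′ ℕ.* 2))))

    frame′ = separatingFrame few combinations
    x = proj₁ frame′
    y = proj₁ (proj₂ frame′)
    separated = proj₂ (proj₂ frame′)

  -- K² has F-dimension 2m = 2 + 2m′, so a span of at least 2m′ independent vectors is cut out by at
  -- most two forms.
  splitEquations : ∀ {n} {w : Vector K².Carrierᴹ n} → m′ ℕ.* 2 ≤ n → Equations w → Splitting (SpanOf K² w)
  splitEquations {n} {w} 2m′≤n equations = Splitting-resp complete sound (split number≤2 φ linear)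
    where
    open Equations equations
    number≤2 : number ≤ 2
    number≤2 = ℕ.+-cancelʳ-≤ (m′ ℕ.* 2) number 2 (ℕ.≤-trans (ℕ.+-monoʳ-≤ number 2m′≤n) number+n≤)

  -- The family `w` may be dependent; the extension supplies independent vectors with the same span,
  -- to which `equations` applies.
  splitExtension : ∀ {j n} {v : Vector K².Carrierᴹ j} {w : Vector K².Carrierᴹ n} → m′ ℕ.* 2 ≤ j →
    Extension (SpanOf K² w) v w → Splitting (SpanOf K² w)
  splitExtension {j} 2m′≤j extension = Splitting-resp (SpanOf-⊆ K² contained) (SpanOf-⊆ K² generates)
    (splitEquations (ℕ.≤-trans 2m′≤j (ℕ.m≤n+m j added)) (equations independent))
    where open Extension extension

  -- The projection is made injective only on the span of the last 2m - 2 vectors. That already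
  -- bounds the codimension of the whole image by two.
  splitImage : ∀ {r} (b : Vector Kᵏ.Carrierᴹ (r ℕ.+ m′ ℕ.* 2)) → 𝔽ᵏ.LinearlyIndependent b →
    ∃[ x ] ∃[ y ] Splitting (SpanOf K² (projection (frame x y) ∘ b))
  splitImage {r} b independent =
    let x , y , injective = injectiveFrame (b ∘ (r ↑ʳ_)) (tail-independent Kᵏ r {w = b} independent)
        w = projection (frame x y) ∘ b
    in x , y , splitExtension ℕ.≤-refl
         (extend {S = SpanOf K² w} (w ∘ (r ↑ʳ_)) w (λ i → ∈-SpanOf K² w (r ↑ʳ i)) (∈-SpanOf K² w) injective)

  -- The pullback of the form g along the projection: `functional X g ∙ u` equals
  -- `g ∙ projection X u`.
  functional : Vector (Vector Scalar k) 2 → Vector Scalar 2 → Vector Scalar k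
  functional X g = LinearAlgebra.linearCombination (K^k E k) g X

  -- The first two columns of a frame form the identity matrix, so the pullback has g₀ and g₁ as its
  -- first two coordinates.
  functional-nonzero : ∀ x y {g} → IsNonzero g → IsNonzero (functional (frame x y) g)
  functional-nonzero x y (zero , g₀≉0) = zero , λ e → g₀≉0 (trans
    (sym (trans (+-cong (*-identityʳ _) (trans (+-identityʳ _) (zeroʳ _))) (+-identityʳ _))) e)
  functional-nonzero x y (suc zero , g₁≉0) = suc zero , λ e → g₁≉0 (trans
    (sym (trans (+-cong (zeroʳ _) (trans (+-identityʳ _) (*-identityʳ _))) (+-identityˡ _))) e)

  Kernel-isHyperplane : {h : Vector Scalar k} → IsNonzero h → IsHyperplane E k (Kernel h)
  Kernel-isHyperplane {h} (_ , h-p≉0) = Kernel-isSubspace h , suc k′ , ≡.refl , Kernel-dimension h h-p≉0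

  module _ {n} {U : Pred Kᵏ.Carrierᴹ u} (subspace : 𝔽ᵏ.IsSubspace U) {basis : Vector Kᵏ.Carrierᴹ n}
           (isBasis : 𝔽ᵏ.IsBasisOf U basis) (X : Vector (Vector Scalar k) 2)
           (splitting : Splitting (SpanOf K² (projection X ∘ basis))) where

    open 𝔽ᵏ.IsSubspace subspace
    open 𝔽ᵏ.IsBasisOf isBasis
    open Splitting splitting

    -- The part y of the projected x is a combination of the projected basis; the same coefficients
    -- give z in `U` lying over y. Then g₂ ∙ y = 0 puts z in the second kernel, and g₁ ∙ y = g₁ ∙
    -- `projection X x` puts x - z in the first.
    decompose : ∀ {x} → x ∈ U →
      x ∈ ((Kernel (functional X g₁) ∩ U) 𝔽ᵏ.+ˢ (Kernel (functional X g₂) ∩ U))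
    decompose {x} x∈U =
      let a , x≈ = generates x∈U
          y , (a′ , y≈) , g₁∙y≈ , g₂∙y≈0 = part (a , λ s → trans (IsLinear.cong (projection-linear X) x≈ s)
            (linearCombination-homo (projection-linear X) a basis s))
          z : Vector Scalar k
          z = 𝔽ᵏ.linearCombination a′ basis
          z∈U : z ∈ U
          z∈U = linearCombination-closed Kᵏ subspace a′ contained
          functional-∙-z : ∀ g → functional X g ∙ z ≈ g ∙ y
          functional-∙-z g = trans (linearCombination-∙ g X z) (IsLinear.cong (∙-linearʳ g) λ s →
            trans (linearCombination-homo (projection-linear X) a′ basis s) (sym (y≈ s)))
          h₁ = functional X g₁
      in (λ i → x i - z i) , z
         , (lift (trans (IsLinear.+-homo (∙-linearʳ h₁) x (λ i → - z i))
             (trans (+-cong (trans (linearCombination-∙ g₁ X x) (trans (sym g₁∙y≈) (sym (functional-∙-z g₁))))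
                            (-ᴹ-homo (∙-linearʳ h₁) z))
               (-‿inverseʳ _)))
           , +-closed x∈U (-ᴹ-closed Kᵏ subspace z∈U))
         , (lift (trans (functional-∙-z g₂) g₂∙y≈0) , z∈U)
         , λ i → sym (x-y+y≈x (x i) (z i))

  spannable : ∀ {r} {U : Pred Kᵏ.Carrierᴹ u} → IsSystem E k (r ℕ.+ m′ ℕ.* 2) U → Is2Spannable E k U
  spannable {r = r} {U = U} system =
    let basis , isBasis = dimension
        x , y , splitting = splitImage {r} basis (𝔽ᵏ.IsBasisOf.independent isBasis)
    in Kernel (functional (frame x y) (g₁ splitting)) , Kernel (functional (frame x y) (g₂ splitting)) ,
       Kernel-isHyperplane (functional-nonzero x y (g₁-nonzero splitting)) ,
       Kernel-isHyperplane (functional-nonzero x y (g₂-nonzero splitting)) ,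
       decompose isSubspace isBasis (frame x y) splitting ,
       λ { (y , z , (_ , y∈U) , (_ , z∈U) , e) → resp (Kᵏ.≈ᴹ-sym e) (+-closed y∈U z∈U) }
    where
    open Splitting using (g₁; g₂; g₁-nonzero; g₂-nonzero)
    open IsSystem system
    open 𝔽ᵏ.IsSubspace isSubspace

-- From the numerical hypotheses to the theorem.

IsPrimePower⇒>1 : ∀ {q} → IsPrimePower q → 1 < q
IsPrimePower⇒>1 (p , e , p-prime , e≥1 , ≡.refl) =
  ℕ.^-monoʳ-< p (ℕ.nonTrivial⇒n>1 p {{prime⇒nonTrivial p-prime}}) e≥1

open import Data.Nat.Base using (_+_; _*_; _≥_; _>_)

theorem4p7 : ∀ {c ℓ₁ ℓ₂ u : Level} (q m n k : ℕ) →
    IsPrimePower q → m ≥ 1 → n ≥ 1 → k ≥ 2 →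
    (E : FiniteFieldExtension q m c ℓ₁ ℓ₂) →
    (U : Pred (LeftModule.Carrierᴹ (K^k E k)) u) →
    IsSystem E k n U →
    n + 3 > 2 * m →
    Is2Spannable E k U
theorem4p7 q (suc m′) n (suc zero) _ _ _ (s≤s ())
theorem4p7 q (suc m′) n (suc (suc k′)) q-primePower _ _ _ E U system n+3>2m =
  -- The dimension is split as n = r + (2m - 2), with the r surplus basis vectors in front.
  System.spannable E (IsPrimePower⇒>1 q-primePower) k′ {r = n ℕ.∸ m′ * 2}
    (≡.subst (λ n → IsSystem E _ n U) (≡.sym (ℕ.m∸n+n≡m 2m′≤n)) system)
  where
  2m′≤n : m′ * 2 ≤ n
  -- The strict bound reads 2m + 1 ≤ n + 3, and 2m + 1 = 3 + 2m′.
  2m′≤n = ℕ.+-cancelˡ-≤ 3 _ _ (≡.subst₂ _≤_ (≡.cong suc (ℕ.*-comm 2 (suc m′))) (ℕ.+-comm n 3) n+3>2m)
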